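{- Let $L$ be a continuous lattice, let $B_L$ be a basis for $L$ with $\bot\notin B_L$, let $E$ be a system of $m$ equations over $L$ of the form $\boldsymbol{x} =_{\boldsymbol{\eta}} \boldsymbol{f}(\boldsymbol{x})$, and let $(\varphi_b^i)_{b\in B_L,\,i\in\underline{m}}$ be a symbolic $\exists$-move for $E$. Then the system of fixpoint equations for computing the progress measure can be written (in the sense of having the same least solution as the progress measure equations for $E$), for all $b\in B_L$ and $i\in\underline{m}$, as $R(b)(i)=R^i_{\varphi^i_b}$, where $R^i_\psi$ is defined inductively on formulae $\psi$ by $$R^i_{[b,j]}=\min\nolimits_{\preceq_i}\{\sup\{R(b')(j)+\boldsymbol{\delta}^{\eta_i}_i\mid b'\in B_L,\ b'\ll b\}\},\qquad R^i_{\bigvee_{k\in K}\varphi_k}=\min_{k\in K}R^i_{\varphi_k},\qquad R^i_{\bigwedge_{k\in K}\varphi_k}=\sup_{k\in K}R^i_{\varphi_k}.$$ Moreover, whenever the basis element $b$ is compact (i.e. $b\ll b$), the clause for atoms becomes $R^i_{[b,j]}=\min_{\preceq_i}\{R(b)(j)+\boldsymbol{\delta}^{\eta_i}_i\}$ (i.e. in the inductive definition of $R^i_\psi$ used in the system of equations $R(b)(i)=R^i_{\varphi^i_b}$, $b\in B_L$, $i\in\underline{m}$, the clause for atoms $[b,j]$ with $b$ compact may be replaced by this simpler clause, with the same least solution).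
   Context: "Lattice" means complete lattice $(L,\sqsubseteq)$, with bottom $\bot$. $\underline{m}=\{1,\dots,m\}$, and $L^m$ carries the pointwise order. A basis of $L$ is $B_L\subseteq L$ with $l=\bigsqcup\{b\in B_L\mid b\sqsubseteq l\}$ for every $l\in L$. $l\ll l'$ iff for every directed $D\subseteq L$ with $l'\sqsubseteq\bigsqcup D$ there is $d\in D$ with $l\sqsubseteq d$. $L$ is continuous if $l=\bigsqcup\{l'\mid l'\ll l\}$ for all $l$. The height $\lambda_L$ is the supremum of the lengths of strictly ascending, possibly transfinite, chains in $L$. A system $E$ of $m$ equations, written $\boldsymbol{x}=_{\boldsymbol{\eta}}\boldsymbol{f}(\boldsymbol{x})$, is an ordered list $x_i=_{\eta_i} f_i(x_1,\dots,x_m)$, $i\in\underline{m}$, with $f_i\colon L^m\to L$ monotone and $\eta_i\in\{\mu,\nu\}$. Let $\mathbf{E}(b,i)=\{\boldsymbol{l}\in L^m\mid b\sqsubseteq f_i(\boldsymbol{l})\}$ for $b\in B_L$, $i\in\underline m$, and $\mathbf{A}(\boldsymbol{l})=\{(b,i)\mid i\in\underline{m},\ b\in B_L,\ b\ll l_i\}$ for $\boldsymbol l\in L^m$. Logic $\mathcal{L}_m(B_L)$: formulae are $\varphi::=[b,j]\mid\bigvee_{k\in K}\varphi_k\mid\bigwedge_{k\in K}\varphi_k$ with $b\in B_L$, $j\in\underline{m}$, and $K$ an arbitrary index set. Semantics $[\![\varphi]\!]\subseteq L^m$ (an upward-closed set): $[\![[b,j]]\!]=\{\boldsymbol{l}\in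 L^m\mid b\sqsubseteq l_j\}$, disjunction is union, conjunction is intersection (empty conjunction denotes $L^m$). A symbolic $\exists$-move for $E$ is a family of formulae $(\varphi_b^i)_{b\in B_L,i\in\underline{m}}$ in $\mathcal{L}_m(B_L)$ with $[\![\varphi^i_b]\!]=\mathbf{E}(b,i)$ for all $b,i$. Ordinal vectors: $[\lambda]^m_\star=\{\beta\mid\beta\le\lambda\}^m\cup\{\star\}$ for an ordinal $\lambda$. $\preceq$ is the lexicographic order with the last component most relevant, with $\star$ as added top. $\preceq_i$ compares lexicographically only components $i,\dots,m$ (with $\star$ strictly above all tuples). For a set $X$ containing tuples, $\min_{\preceq_i}X=(0,\dots,0,x_i,\dots,x_m)$ where $(x_i,\dots,x_m)$ is the lexicographic minimum of the restrictions to components $i,\dots,m$ of the tuples in $X$; $\min_{\preceq_i}\emptyset=\min_{\preceq_i}\{\star\}=\star$. $\min_{k\in K}$ and $\sup_{k\in K}$ are with respect to $\preceq$ in $[\lambda_L]^m_\star$ (empty minimum is $\star$, empty supremum is $(0,\dots,0)$). $\boldsymbol{\delta}^{\nu}_i$ is the null $m$-vector and $\boldsymbol{\delta}^{\mu}_i$ the $m$-vector with $1$ in position $i$ and $0$ elsewhere. The progress measure equations for $E$, for functions $R\colon B_L\to\underline{m}\to[\lambda_L]^m_\star$, are $$R(b)(i)=\min\nolimits_{\preceq_i}\{\sup\{R(b')(j)+\boldsymbol{\delta}^{\eta_i}_i\mid(b',j)\in\mathbf{A}(\boldsymbol{l})\}\mid\boldsymbol{l}\in\mathbf{E}(b,i)\}\qquad(b\in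 B_L,\ i\in\underline{m}).$$ Addition is componentwise, $\star+\boldsymbol{\delta}=\star$; a supremum of vectors is the least element of $[\lambda_L]^m_\star$ that is $\succeq$ all of them, where a vector whose $i$-th component is $\lambda_L+1$ is compared lexicographically as a vector of ordinals (and a single such vector is identified with the least element of $[\lambda_L]^m_\star$ above it). Least solutions are with respect to the pointwise order induced by $\preceq$. -}

module Defs where

open import Level using (Level; suc)
open import Data.Bool.Base using (if_then_else_)
open import Data.Fin.Base using (Fin; toℕ)
open import Data.Fin.Properties using (_≟_)
open import Data.Maybe.Base as Maybe using (Maybe; just; nothing)
open import Data.Maybe.Relation.Unary.All using (All)
open import Data.Nat.Base as ℕ using (ℕ)
open import Data.Product.Base using (Σ; ∃; ∃₂; _×_; _,_; proj₁; proj₂)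
open import Data.Sum.Base using (_⊎_)
open import Data.Sum.Relation.Binary.LeftOrder using (⊎-<-strictTotalOrder; ⊎-<-wellFounded)
open import Data.Unit.Polymorphic.Base using () renaming (⊤ to ⊤ₚ)
open import Data.Empty.Polymorphic using () renaming (⊥ to ⊥ₚ)
open import Data.Vec.Functional using (Vector)
open import Induction.WellFounded using (WellFounded; acc)
open import Relation.Binary.Bundles using (Poset; StrictTotalOrder)
open import Relation.Binary.Core using (Rel)
open import Relation.Binary.Definitions using (tri≈)
open import Relation.Binary.Morphism.Structures using (IsOrderHomomorphism)
open import Relation.Binary.PropositionalEquality.Core using (_≡_; refl)
open import Relation.Binary.PropositionalEquality.Properties using (isEquivalence)
open import Relation.Nullary.Decidable.Core using (does)
open import Relation.Nullary.Negation.Core using (¬_)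
open import Relation.Unary using (Pred; _∈_; _≐_)
import Relation.Binary.Construct.NonStrictToStrict as ToStrict

------------------------------------------------------------------------
-- Ordinals, as well-ordered setoids compared by order type

record Ordinal (ℓ : Level) : Set (suc ℓ) where
  field
    strictTotalOrder : StrictTotalOrder ℓ ℓ ℓ
  open StrictTotalOrder strictTotalOrder public
    using (Carrier; _≈_; _<_)
  field
    wellFounded : WellFounded _<_

module _ {ℓ : Level} where

  infix 4 _≤ᵒ_ _≈ᵒ_ _<ᵒ_
  infixl 6 _+ᵒ_

  -- Between well-orders, a strictly monotone map exists exactly when the first
  -- is isomorphic to an initial segment of the second.
  _≤ᵒ_ : Rel (Ordinal ℓ) ℓ
  α ≤ᵒ β = ∃ (IsOrderHomomorphism α._≈_ β._≈_ α._<_ β._<_)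
    where
    module α = Ordinal α
    module β = Ordinal β

  _≈ᵒ_ : Rel (Ordinal ℓ) ℓ
  α ≈ᵒ β = α ≤ᵒ β × β ≤ᵒ α

  _<ᵒ_ : Rel (Ordinal ℓ) ℓ
  α <ᵒ β = α ≤ᵒ β × ¬ (β ≤ᵒ α)

  0ᵒ : Ordinal ℓ
  0ᵒ = record
    { strictTotalOrder = record
      { Carrier = ⊥ₚ
      ; _≈_ = _≡_
      ; _<_ = λ _ _ → ⊥ₚ
      ; isStrictTotalOrder = record
        { isStrictPartialOrder = record
          { isEquivalence = isEquivalence
          ; irrefl = λ _ ()
          ; trans = λ { () }
          ; <-resp-≈ = (λ { refl () }) , (λ { refl () })
          }
        ; compare = λ ()
        }
      }
    ; wellFounded = λ ()
    }

  1ᵒ : Ordinal ℓ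
  1ᵒ = record
    { strictTotalOrder = record
      { Carrier = ⊤ₚ
      ; _≈_ = _≡_
      ; _<_ = λ _ _ → ⊥ₚ
      ; isStrictTotalOrder = record
        { isStrictPartialOrder = record
          { isEquivalence = isEquivalence
          ; irrefl = λ _ ()
          ; trans = λ { () }
          ; <-resp-≈ = (λ { refl () }) , (λ { refl () })
          }
        ; compare = λ _ _ → tri≈ (λ ()) refl (λ ())
        }
      }
    ; wellFounded = λ _ → acc λ ()
    }

  _+ᵒ_ : Ordinal ℓ → Ordinal ℓ → Ordinal ℓ
  α +ᵒ β = record
    { strictTotalOrder = ⊎-<-strictTotalOrder {d = ℓ} {ℓ} {ℓ} α.strictTotalOrder β.strictTotalOrder
    ; wellFounded = ⊎-<-wellFounded α.wellFounded β.wellFounded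
    }
    where
    module α = Ordinal α
    module β = Ordinal β

------------------------------------------------------------------------
-- Lattices

-- Carrier, relations and indexing sets all live in one universe.  Least upper
-- bounds of predicates from higher universes (such as _≪ l) are expressed by IsLub.
record CompleteLattice (ℓ : Level) : Set (suc ℓ) where
  field
    poset : Poset ℓ ℓ ℓ

  open Poset poset public
    using (Carrier; _≈_)
    renaming (_≤_ to _⊑_)
  open ToStrict _≈_ _⊑_ public
    using ()
    renaming (_<_ to _⊏_)

  IsLub : ∀ {p} → Pred Carrier p → Carrier → Set _
  IsLub P l = (∀ {x} → x ∈ P → x ⊑ l) × (∀ u → (∀ {x} → x ∈ P → x ⊑ u) → l ⊑ u)

  field
    ⨆ : Pred Carrier ℓ → Carrier
    ⨆-isLub : ∀ P → IsLub P (⨆ P)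

  ⊥ᴸ : Carrier
  ⊥ᴸ = ⨆ (λ _ → ⊥ₚ)

  Directed : Pred Carrier ℓ → Set ℓ
  Directed D =
    (∃ λ d → d ∈ D) ×
    (∀ {x y} → x ∈ D → y ∈ D → ∃ λ z → z ∈ D × x ⊑ z × y ⊑ z)

  infix 4 _≪_

  _≪_ : Rel Carrier (suc ℓ)
  l ≪ l′ = (D : Pred Carrier ℓ) → Directed D → l′ ⊑ ⨆ D → ∃ λ d → d ∈ D × l ⊑ d

  Compact : Pred Carrier (suc ℓ)
  Compact l = l ≪ l

  IsContinuous : Set (suc ℓ)
  IsContinuous = ∀ l → IsLub (λ l′ → l′ ≪ l) l

  IsBasis : Pred Carrier ℓ → Set ℓ
  IsBasis B = ∀ l → IsLub (λ b → b ∈ B × b ⊑ l) l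

  -- A strictly ascending chain of length α is a family (l_β)_{β<α}; the elements
  -- of an ordinal stand for the ordinals below it.
  Chain : Ordinal ℓ → Set ℓ
  Chain α = ∃ (IsOrderHomomorphism α._≈_ _≈_ α._<_ _⊏_)
    where module α = Ordinal α

  IsHeight : Ordinal ℓ → Set (suc ℓ)
  IsHeight λᴸ =
    (∀ α → Chain α → α ≤ᵒ λᴸ) ×
    (∀ β → (∀ α → Chain α → α ≤ᵒ β) → λᴸ ≤ᵒ β)

------------------------------------------------------------------------
-- Systems of fixpoint equations (components are numbered from 0)

data FixpointType : Set where
  μ ν : FixpointType

record System {ℓ : Level} (L : CompleteLattice ℓ) (m : ℕ) : Set ℓ where
  open CompleteLattice L
  field
    η : Fin m → FixpointType
    f : Fin m → Vector Carrier m → Carrier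
    f-mono : ∀ i {l l′} → (∀ j → l j ⊑ l′ j) → f i l ⊑ f i l′

------------------------------------------------------------------------
-- Ordinal vectors with ⋆

module OrdinalVectors {ℓ : Level} (m : ℕ) where

  OrdVec : Set (suc ℓ)
  OrdVec = Vector (Ordinal ℓ) m

  OrdVec⋆ : Set (suc ℓ)
  OrdVec⋆ = Maybe OrdVec

  pattern ⋆ = nothing

  infix 4 _≈[_]_ _≺[_]_ _≼[_]_ _⪯[_]_ _⪯_

  _≈[_]_ : OrdVec → ℕ → OrdVec → Set ℓ
  v ≈[ i ] w = ∀ k → i ℕ.≤ toℕ k → v k ≈ᵒ w k

  _≺[_]_ : OrdVec → ℕ → OrdVec → Set ℓ
  v ≺[ i ] w = ∃ λ k →
    i ℕ.≤ toℕ k × v k <ᵒ w k × (∀ j → toℕ k ℕ.< toℕ j → v j ≈ᵒ w j)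

  _≼[_]_ : OrdVec → ℕ → OrdVec → Set ℓ
  v ≼[ i ] w = v ≺[ i ] w ⊎ v ≈[ i ] w

  _⪯[_]_ : OrdVec⋆ → ℕ → OrdVec⋆ → Set ℓ
  _      ⪯[ i ] ⋆      = ⊤ₚ
  ⋆      ⪯[ i ] just w = ⊥ₚ
  just v ⪯[ i ] just w = v ≼[ i ] w

  _⪯_ : Rel OrdVec⋆ ℓ
  x ⪯ y = x ⪯[ 0 ] y

  δ : FixpointType → Fin m → OrdVec
  δ ν i k = 0ᵒ
  δ μ i k = if does (k ≟ i) then 1ᵒ else 0ᵒ

  infixl 6 _⊕_

  _⊕_ : OrdVec⋆ → OrdVec → OrdVec⋆
  x ⊕ d = Maybe.map (λ v k → v k +ᵒ d k) x

  module _ (λᴸ : Ordinal ℓ) where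

    [λ]⋆ : Set (suc ℓ)
    [λ]⋆ = Σ OrdVec⋆ (All (λ v → ∀ k → v k ≤ᵒ λᴸ))

    -- IsSup X x means x = sup X.  The elements of X may have components
    -- exceeding λᴸ, but x ranges over [λ]⋆.
    IsSup : ∀ {p} → Pred OrdVec⋆ p → [λ]⋆ → Set _
    IsSup X x =
      (∀ {y} → y ∈ X → y ⪯ proj₁ x) ×
      (∀ (u : [λ]⋆) → (∀ {y} → y ∈ X → y ⪯ proj₁ u) → proj₁ x ⪯ proj₁ u)

    -- IsMin i X x means x = min_{⪯ᵢ} X.  As components are numbered from 0,
    -- IsMin 0 is the minimum with respect to ⪯ itself.
    IsMin : ∀ {p} → ℕ → Pred [λ]⋆ p → [λ]⋆ → Set _
    IsMin i X (⋆ , _) = ∀ {y} → y ∈ X → proj₁ y ≡ ⋆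
    IsMin i X (just v , _) =
      (∀ k → toℕ k ℕ.< i → v k ≈ᵒ 0ᵒ) ×
      (∃₂ λ w w≤λ → (just w , w≤λ) ∈ X × v ≈[ i ] w) ×
      (∀ {y} → y ∈ X → just v ⪯[ i ] proj₁ y)

------------------------------------------------------------------------
-- The logic and the progress measure equations

module Equations
  {ℓ : Level} (L : CompleteLattice ℓ) (B : Pred (CompleteLattice.Carrier L) ℓ)
  (λᴸ : Ordinal ℓ) (m : ℕ)
  where

  open CompleteLattice L
  open OrdinalVectors {ℓ} m

  Basis : Set ℓ
  Basis = ∃ λ b → b ∈ B

  data Formula : Set (suc ℓ) where
    [_,_] : Basis → Fin m → Formula
    ⋁ ⋀   : {K : Set ℓ} → (K → Formula) → Formula

  ⟦_⟧ : Formula → Pred (Vector Carrier m) ℓ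
  ⟦ [ b , j ] ⟧ l = proj₁ b ⊑ l j
  ⟦ ⋁ φ ⟧       l = ∃ λ k → l ∈ ⟦ φ k ⟧
  ⟦ ⋀ φ ⟧       l = ∀ k → l ∈ ⟦ φ k ⟧

  𝐄 : System L m → Basis → Fin m → Pred (Vector Carrier m) ℓ
  𝐄 E b i l = proj₁ b ⊑ System.f E i l

  𝐀 : Vector Carrier m → Pred (Basis × Fin m) (suc ℓ)
  𝐀 l (b , j) = proj₁ b ≪ l j

  IsSymbolicMove : System L m → (Basis → Fin m → Formula) → Set ℓ
  IsSymbolicMove E φ = ∀ b i → ⟦ φ b i ⟧ ≐ 𝐄 E b i

  Measure : Set (suc ℓ)
  Measure = Basis → Fin m → [λ]⋆ λᴸ

  IsLeast : ∀ {p} → Pred Measure p → Measure → Set _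
  IsLeast Solution R =
    R ∈ Solution × (∀ R′ → R′ ∈ Solution → ∀ b i → proj₁ (R b i) ⪯ proj₁ (R′ b i))

  module _ (E : System L m) where
    open System E

    shifted : Measure → Fin m → Basis → Fin m → OrdVec⋆
    shifted R i b j = proj₁ (R b j) ⊕ δ (η i) i

    SolvesProgressMeasureEqs : Pred Measure (suc ℓ)
    SolvesProgressMeasureEqs R = ∀ b i →
      IsMin λᴸ (toℕ i)
        (λ y → ∃ λ l → l ∈ 𝐄 E b i ×
          IsSup λᴸ (λ z → ∃₂ λ b′ j → (b′ , j) ∈ 𝐀 l × z ≡ shifted R i b′ j) y)
        (R b i)

    -- AtomClause R i b j x means "x is the value of R^i_{[b,j]}".
    AtomClause : Set (suc (suc ℓ))
    AtomClause = Measure → Fin m → Basis → Fin m → Pred ([λ]⋆ λᴸ) (suc ℓ)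

    atomClause : AtomClause
    atomClause R i b j =
      IsMin λᴸ (toℕ i)
        (IsSup λᴸ (λ z → ∃ λ b′ → proj₁ b′ ≪ proj₁ b × z ≡ shifted R i b′ j))

    -- The single vector is identified with the least element of [λ]⋆ above it,
    -- that is, with the supremum of its singleton.
    compactClause : AtomClause
    compactClause R i b j =
      IsMin λᴸ (toℕ i) (IsSup λᴸ (λ z → z ≡ shifted R i b j))

    atomClauseᶜ : AtomClause
    atomClauseᶜ R i b j x =
      (Compact (proj₁ b) → compactClause R i b j x) ×
      (¬ Compact (proj₁ b) → atomClause R i b j x)

    -- Value clause R i ψ x means "x is the value of R^i_ψ", where clause is used for atoms.
    Value : AtomClause → Measure → Fin m → Formula → Pred ([λ]⋆ λᴸ) (suc ℓ)
    Value clause R i [ b , j ] x = clause R i b j x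
    Value clause R i (⋁ φ)     x =
      IsMin λᴸ 0 (λ y → ∃ λ k → Value clause R i (φ k) y) x
    Value clause R i (⋀ φ)     x =
      IsSup λᴸ (λ z → ∃₂ λ k y → Value clause R i (φ k) y × z ≡ proj₁ y) x

    SolvesSymbolicEqs : AtomClause → (Basis → Fin m → Formula) → Pred Measure (suc ℓ)
    SolvesSymbolicEqs clause φ R = ∀ b i → Value clause R i (φ b i) (R b i)

{-# OPTIONS --safe #-}
module Submission where

-- For a measure R, a component i and a vector u, let G(R,i,u) be the tuple whose j-th
-- entry is the join of the basis elements c with R(c)(j) + δᵢ ⪯ᵢ u.  For either system of
-- equations, R(b)(i) ⪯ u at a solution R forces b ⊑ fᵢ(G(R,i,u)).  Let R* be the least
-- measure satisfying this implication for all b, i and u; it then also satisfies the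
-- converse, so each set {b ∣ R*(b)(i) ⪯ u} contains every basis element below its join.
-- Hence b ≪ G(R*,i,u)ⱼ already gives R*(b)(j) + δᵢ ⪯ᵢ u, and the value at R* of any formula
-- ψ is ⪯ᵢ u exactly when G(R*,i,u) ∈ ⟦ψ⟧.  So the syntactic shape of the symbolic ∃-move
-- is irrelevant at R*, which solves, and lies below every solution of, all the systems.

open import Defs
open import Level using (Level; lower)
open import Axiom.ExcludedMiddle using (ExcludedMiddle)
open import Data.Bool.Base using (true; false)
open import Data.Empty using (⊥-elim)
open import Data.Fin.Base using (Fin; toℕ)
open import Data.Fin.Properties using (toℕ<n; toℕ-injective; <-cmp; _≟_)
open import Data.Maybe.Base using (just; nothing)
open import Data.Maybe.Relation.Unary.All as Maybe using (All; just; nothing)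
open import Data.Nat.Base as ℕ using (ℕ; zero; suc; z≤n)
import Data.Nat.Properties as ℕ
open import Data.Product.Base using (Σ; ∃; ∃₂; _×_; _,_; proj₁; proj₂)
open import Data.Sum.Base as Sum using (_⊎_; inj₁; inj₂)
open import Data.Sum.Relation.Binary.LeftOrder as LeftOrder using (₁∼₁; ₁∼₂; ₂∼₂)
open import Data.Sum.Relation.Binary.Pointwise as Pointwise using (inj₁; inj₂)
open import Data.Unit.Polymorphic.Base using (tt)
open import Data.Vec.Functional using (Vector)
open import Function.Base using (_∘_; id)
open import Induction.WellFounded using (WellFounded; Acc; acc)
open import Relation.Binary.Bundles using (Poset; StrictTotalOrder)
open import Relation.Binary.Core using (Rel)
open import Relation.Binary.Definitions using (tri<; tri≈; tri>)
open import Relation.Binary.Morphism.Structures using (IsOrderHomomorphism)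
open import Relation.Binary.PropositionalEquality using (_≡_; refl; sym; subst; subst₂)
open import Relation.Nullary.Decidable.Core using (yes; no; does; decidable-stable)
open import Relation.Nullary.Negation.Core using (¬_)
open import Relation.Unary using (Pred; _∈_)

-- Order and addition of ordinals.

module _ {ℓ : Level} where

  ≤ᵒ-refl : (α : Ordinal ℓ) → α ≤ᵒ α
  ≤ᵒ-refl α = id , record { cong = id ; mono = id }

  ≤ᵒ-trans : (α β γ : Ordinal ℓ) → α ≤ᵒ β → β ≤ᵒ γ → α ≤ᵒ γ
  ≤ᵒ-trans α β γ (f , f-hom) (g , g-hom) = g ∘ f , record
    { cong = G.cong ∘ F.cong
    ; mono = G.mono ∘ F.mono
    }
    where
    module F = IsOrderHomomorphism f-hom
    module G = IsOrderHomomorphism g-hom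

  0≤ᵒ : (α : Ordinal ℓ) → 0ᵒ ≤ᵒ α
  0≤ᵒ α = (λ ()) , record { cong = λ { {()} } ; mono = λ { {()} } }

  ≈ᵒ-refl : (α : Ordinal ℓ) → α ≈ᵒ α
  ≈ᵒ-refl α = ≤ᵒ-refl α , ≤ᵒ-refl α

  ≈ᵒ-sym : (α β : Ordinal ℓ) → α ≈ᵒ β → β ≈ᵒ α
  ≈ᵒ-sym _ _ (p , q) = q , p

  ≈ᵒ-trans : (α β γ : Ordinal ℓ) → α ≈ᵒ β → β ≈ᵒ γ → α ≈ᵒ γ
  ≈ᵒ-trans α β γ (p , q) (r , s) = ≤ᵒ-trans α β γ p r , ≤ᵒ-trans γ β α s q

  <-≤ᵒ-trans : (α β γ : Ordinal ℓ) → α <ᵒ β → β ≤ᵒ γ → α <ᵒ γ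
  <-≤ᵒ-trans α β γ (p , q) r = ≤ᵒ-trans α β γ p r , λ s → q (≤ᵒ-trans β γ α r s)

  ≤-<ᵒ-trans : (α β γ : Ordinal ℓ) → α ≤ᵒ β → β <ᵒ γ → α <ᵒ γ
  ≤-<ᵒ-trans α β γ p (q , r) = ≤ᵒ-trans α β γ p q , λ s → r (≤ᵒ-trans γ α β s p)

  +ᵒ-monoˡ-≤ : (α β γ : Ordinal ℓ) → α ≤ᵒ β → α +ᵒ γ ≤ᵒ β +ᵒ γ
  +ᵒ-monoˡ-≤ α β γ (f , f-hom) = Sum.map₁ f , record
    { cong = λ { (inj₁ p) → inj₁ (F.cong p) ; (inj₂ p) → inj₂ p }
    ; mono = λ { ₁∼₂ → ₁∼₂ ; (₁∼₁ p) → ₁∼₁ (F.mono p) ; (₂∼₂ p) → ₂∼₂ p }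
    }
    where module F = IsOrderHomomorphism f-hom

  -- The hypothesis says γ is 0 or 1; right cancellation fails for larger γ.
  +ᵒ-cancelʳ-≤ : (α β γ : Ordinal ℓ) → (∀ {x y} → ¬ Ordinal._<_ γ x y) →
    α +ᵒ γ ≤ᵒ β +ᵒ γ → α ≤ᵒ β
  +ᵒ-cancelʳ-≤ α β γ γ-discrete (f , f-hom) = proj₁ ∘ restrict , record
    { cong = λ {x} {y} x≈y → Pointwise.drop-inj₁
        (subst₂ (Ordinal._≈_ (β +ᵒ γ)) (proj₂ (restrict x)) (proj₂ (restrict y)) (F.cong (inj₁ x≈y)))
    ; mono = λ {x} {y} x<y → LeftOrder.drop-inj₁
        (subst₂ (Ordinal._<_ (β +ᵒ γ)) (proj₂ (restrict x)) (proj₂ (restrict y)) (F.mono (₁∼₁ x<y)))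
    }
    where
    module F = IsOrderHomomorphism f-hom
    restrict : ∀ x → ∃ λ y → f (inj₁ x) ≡ inj₁ y
    restrict x with f (inj₁ x) in eq
    ... | inj₁ y = y , refl
    ... | inj₂ c with f (inj₂ c) | subst (λ z → Ordinal._<_ (β +ᵒ γ) z (f (inj₂ c))) eq (F.mono ₁∼₂)
    ...   | inj₂ _ | ₂∼₂ lt = ⊥-elim (γ-discrete lt)

  x+0≤ᵒx : (α : Ordinal ℓ) → α +ᵒ 0ᵒ ≤ᵒ α
  x+0≤ᵒx α = (λ { (inj₁ x) → x }) , record
    { cong = λ { {inj₁ _} {inj₁ _} (inj₁ p) → p }
    ; mono = λ { {inj₁ _} {inj₁ _} (₁∼₁ p) → p }
    }

  -- Ranks of points in well-orders.

  Point : Set (Level.suc ℓ)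
  Point = Σ (Ordinal ℓ) Ordinal.Carrier

  infix 4 _≲_

  -- Comparison of ranks of elements of possibly different well-orders.
  data _≲_ (p q : Point) : Set ℓ where
    dominated :
      (∀ {a} → Ordinal._<_ (proj₁ p) a (proj₂ p) →
        ∃ λ b → Ordinal._<_ (proj₁ q) b (proj₂ q) × (proj₁ p , a) ≲ (proj₁ q , b)) →
      p ≲ q

  ≲-trans : ∀ {p q r} → p ≲ q → q ≲ r → p ≲ r
  ≲-trans (dominated f) (dominated g) = dominated λ a<p →
    let (b , b<q , a≲b) = f a<p
        (c , c<r , b≲c) = g b<q
    in c , c<r , ≲-trans a≲b b≲c

  ≲-respˡ : ∀ α q {a a′} → Ordinal._≈_ α a′ a → (α , a) ≲ q → (α , a′) ≲ q
  ≲-respˡ α q a′≈a (dominated f) =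
    dominated λ x<a′ → f (StrictTotalOrder.<-respʳ-≈ (Ordinal.strictTotalOrder α) a′≈a x<a′)

-- Minima of families of ordinals, classically.

module Classical (em : ∀ {a} → ExcludedMiddle a) where

  byContradiction : ∀ {a} {A : Set a} → ¬ ¬ A → A
  byContradiction = decidable-stable em

  least : ∀ {a r p} {A : Set a} {_<_ : Rel A r} → WellFounded _<_ →
    (P : Pred A p) → ∃ P → ∃ λ x → P x × (∀ {y} → y < x → ¬ P y)
  least {_<_ = _<_} wf P (x , Px) = go (wf x) Px
    where
    go : ∀ {x} → Acc _<_ x → P x → ∃ λ x → P x × (∀ {y} → y < x → ¬ P y)
    go {x} (acc rs) Px with em {P = ∃ λ y → y < x × P y}
    ... | yes (y , y<x , Py) = go (rs y<x) Py
    ... | no ∄y              = x , Px , λ y<x Py → ∄y (_ , y<x , Py)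

  module _ {ℓ : Level} where

    -- Failure of domination gives a predecessor `a′` of `a` dominated by no predecessor of `b`. By
    -- induction, each predecessor of `b` is then dominated by a point below `a′`, so `a′` dominates
    -- `b`.
    ≴⇒below : ∀ (p q : Point {ℓ}) → ¬ p ≲ q →
      ∃ λ a → Ordinal._<_ (proj₁ p) a (proj₂ p) × q ≲ (proj₁ p , a)
    ≴⇒below (α , a) q = go (Ordinal.wellFounded α a) q
      where
      go : ∀ {a} → Acc (Ordinal._<_ α) a → ∀ q → ¬ (α , a) ≲ q →
        ∃ λ a′ → Ordinal._<_ α a′ a × q ≲ (α , a′)
      go {a} (acc rs) (β , b) a≴b with em {P = ∃ λ a′ → Ordinal._<_ α a′ a ×
                                    (∀ {b′} → Ordinal._<_ β b′ b → ¬ (α , a′) ≲ (β , b′))}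
      ... | yes (a′ , a′<a , a′≴) = a′ , a′<a , dominated λ b′<b → go (rs a′<a) _ (a′≴ b′<b)
      ... | no ∄a′ = ⊥-elim (a≴b (dominated λ a′<a → byContradiction λ ∄b′ →
                       ∄a′ (_ , a′<a , λ b′<b a′≲b′ → ∄b′ (_ , b′<b , a′≲b′))))

    -- The map sends each point to the least point of `β` dominating it. It is strictly monotone
    -- because domination of `a′` by `h a′` provides some `b` below `h a′` that dominates `a`.
    ≲⇒≤ᵒ : (α β : Ordinal ℓ) → (∀ a → ∃ λ b → (α , a) ≲ (β , b)) → α ≤ᵒ β
    ≲⇒≤ᵒ α β bound = h , record { cong = h-cong ; mono = h-mono }
      where
      module α = StrictTotalOrder (Ordinal.strictTotalOrder α)
      module β = StrictTotalOrder (Ordinal.strictTotalOrder β)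
      leastBound : ∀ a → ∃ λ b → (α , a) ≲ (β , b) × (∀ {b′} → b′ β.< b → ¬ (α , a) ≲ (β , b′))
      leastBound a = least (Ordinal.wellFounded β) (λ b → (α , a) ≲ (β , b)) (bound a)
      h : α.Carrier → β.Carrier
      h a = proj₁ (leastBound a)
      h-cong : ∀ {a a′} → a α.≈ a′ → h a β.≈ h a′
      h-cong {a} {a′} a≈a′ with β.compare (h a) (h a′)
      ... | tri≈ _ eq _ = eq
      ... | tri< lt _ _ = ⊥-elim (proj₂ (proj₂ (leastBound a′)) lt
                            (≲-respˡ α _ (α.Eq.sym a≈a′) (proj₁ (proj₂ (leastBound a)))))
      ... | tri> _ _ gt = ⊥-elim (proj₂ (proj₂ (leastBound a)) gt
                            (≲-respˡ α _ a≈a′ (proj₁ (proj₂ (leastBound a′)))))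
      h-mono : ∀ {a a′} → a α.< a′ → h a β.< h a′
      h-mono {a} {a′} a<a′ with proj₁ (proj₂ (leastBound a′))
      ... | dominated f with f a<a′
      ...   | b , b<ha′ , a≲b with β.compare (h a) b
      ...     | tri< ha<b _ _ = β.trans ha<b b<ha′
      ...     | tri≈ _ ha≈b _ = β.<-respˡ-≈ (β.Eq.sym ha≈b) b<ha′
      ...     | tri> _ _ b<ha = ⊥-elim (proj₂ (proj₂ (leastBound a)) b<ha a≲b)

    ≰ᵒ⇒unbounded : (α β : Ordinal ℓ) → ¬ α ≤ᵒ β → ∃ λ a → ∀ b → ¬ (α , a) ≲ (β , b)
    ≰ᵒ⇒unbounded α β α≰β = byContradiction λ ∄a → α≰β (≲⇒≤ᵒ α β λ a →
      byContradiction λ ∄b → ∄a (a , λ b a≲b → ∄b (b , a≲b)))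

    -- The well-foundedness of the single ordinal `f x` suffices: if `f x` is not minimal, take its
    -- least point `a` whose rank is reached nowhere in some `f y`. Were `f y` not below `f z`, a
    -- point of `f y` unreached in `f z` would be dominated by some `a′` below `a`, against the
    -- choice of `a`.
    minimum : ∀ {i p} {I : Set i} (f : I → Ordinal ℓ) (P : Pred I p) → ∃ P →
      ∃ λ x → P x × (∀ {y} → P y → f x ≤ᵒ f y)
    minimum f P (x , Px) with em {P = ∃ λ a → ∃ λ y → P y × (∀ b → ¬ (f x , a) ≲ (f y , b))}
    ... | no ∄a = x , Px , λ {y} Py → byContradiction λ x≰y →
            let (a , a≴) = ≰ᵒ⇒unbounded (f x) (f y) x≰y in ∄a (a , y , Py , a≴)
    ... | yes exceeding with least (Ordinal.wellFounded (f x)) _ exceeding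
    ...   | a , (y , Py , a≴y) , a-least = y , Py , λ {z} Pz → byContradiction λ y≰z →
              let (b , b≴z)        = ≰ᵒ⇒unbounded (f y) (f z) y≰z
                  (a′ , a′<a , b≲a′) = ≴⇒below (f x , a) (f y , b) (a≴y b)
              in a-least a′<a (z , Pz , λ c a′≲c → b≴z c (≲-trans b≲a′ a′≲c))

  -- Lexicographic orders on ordinal vectors.

  module Vectors {ℓ : Level} (m : ℕ) where

    open OrdinalVectors {ℓ} m

    ≈[]-refl : ∀ i v → v ≈[ i ] v
    ≈[]-refl i v k _ = ≈ᵒ-refl (v k)

    ≈[]-sym : ∀ i v w → v ≈[ i ] w → w ≈[ i ] v
    ≈[]-sym i v w v≈w k i≤k = ≈ᵒ-sym (v k) (w k) (v≈w k i≤k)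

    ≈[]-trans : ∀ i u v w → u ≈[ i ] v → v ≈[ i ] w → u ≈[ i ] w
    ≈[]-trans i u v w u≈v v≈w k i≤k = ≈ᵒ-trans (u k) (v k) (w k) (u≈v k i≤k) (v≈w k i≤k)

    ≈-≺-trans : ∀ i u v w → u ≈[ i ] v → v ≺[ i ] w → u ≺[ i ] w
    ≈-≺-trans i u v w u≈v (k , i≤k , vk<wk , above) =
      k , i≤k , ≤-<ᵒ-trans (u k) (v k) (w k) (proj₁ (u≈v k i≤k)) vk<wk ,
      λ j k<j → ≈ᵒ-trans (u j) (v j) (w j) (u≈v j (ℕ.≤-trans i≤k (ℕ.<⇒≤ k<j))) (above j k<j)

    ≺-≈-trans : ∀ i u v w → u ≺[ i ] v → v ≈[ i ] w → u ≺[ i ] w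
    ≺-≈-trans i u v w (k , i≤k , uk<vk , above) v≈w =
      k , i≤k , <-≤ᵒ-trans (u k) (v k) (w k) uk<vk (proj₁ (v≈w k i≤k)) ,
      λ j k<j → ≈ᵒ-trans (u j) (v j) (w j) (above j k<j) (v≈w j (ℕ.≤-trans i≤k (ℕ.<⇒≤ k<j)))

    ≺-trans : ∀ i u v w → u ≺[ i ] v → v ≺[ i ] w → u ≺[ i ] w
    ≺-trans i u v w (k , i≤k , uk<vk , u≈v) (l , i≤l , vl<wl , v≈w) with <-cmp k l
    ... | tri< k<l _ _ = l , i≤l , ≤-<ᵒ-trans (u l) (v l) (w l) (proj₁ (u≈v l k<l)) vl<wl ,
          λ j l<j → ≈ᵒ-trans (u j) (v j) (w j) (u≈v j (ℕ.<-trans k<l l<j)) (v≈w j l<j)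
    ... | tri≈ _ refl _ = k , i≤k , <-≤ᵒ-trans (u k) (v k) (w k) uk<vk (proj₁ vl<wl) ,
          λ j k<j → ≈ᵒ-trans (u j) (v j) (w j) (u≈v j k<j) (v≈w j k<j)
    ... | tri> _ _ l<k = k , i≤k , <-≤ᵒ-trans (u k) (v k) (w k) uk<vk (proj₁ (v≈w k l<k)) ,
          λ j k<j → ≈ᵒ-trans (u j) (v j) (w j) (u≈v j k<j) (v≈w j (ℕ.<-trans l<k k<j))

    ≼-trans : ∀ i u v w → u ≼[ i ] v → v ≼[ i ] w → u ≼[ i ] w
    ≼-trans i u v w (inj₁ p) (inj₁ q) = inj₁ (≺-trans i u v w p q)
    ≼-trans i u v w (inj₁ p) (inj₂ q) = inj₁ (≺-≈-trans i u v w p q)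
    ≼-trans i u v w (inj₂ p) (inj₁ q) = inj₁ (≈-≺-trans i u v w p q)
    ≼-trans i u v w (inj₂ p) (inj₂ q) = inj₂ (≈[]-trans i u v w p q)

    ≺-irrefl : ∀ i v → ¬ v ≺[ i ] v
    ≺-irrefl i v (_ , _ , (p , ¬p) , _) = ¬p p

    ≼-antisym : ∀ i v w → v ≼[ i ] w → w ≼[ i ] v → v ≈[ i ] w
    ≼-antisym i v w (inj₂ v≈w) _          = v≈w
    ≼-antisym i v w (inj₁ _)   (inj₂ w≈v) = ≈[]-sym i w v w≈v
    ≼-antisym i v w (inj₁ v≺w) (inj₁ w≺v) = ⊥-elim (≺-irrefl i v (≺-trans i v w v v≺w w≺v))

    ≺-coarsen : ∀ {i j} v w → i ℕ.≤ j → v ≺[ j ] w → v ≺[ i ] w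
    ≺-coarsen v w i≤j (k , j≤k , rest) = k , ℕ.≤-trans i≤j j≤k , rest

    ≼-restrict : ∀ i v w → v ≼[ 0 ] w → v ≼[ i ] w
    ≼-restrict i v w (inj₂ v≈w) = inj₂ λ k _ → v≈w k z≤n
    ≼-restrict i v w (inj₁ (k , _ , vk<wk , above)) with i ℕ.≤? toℕ k
    ... | yes i≤k = inj₁ (k , i≤k , vk<wk , above)
    ... | no  i≰k = inj₂ λ j i≤j → above j (ℕ.≤-trans (ℕ.≰⇒> i≰k) i≤j)

    -- Phrasing the premise through `toℕ k ≡ i` leaves `i` an arbitrary number; it is vacuous once
    -- `i` is at least `m`.
    ≼-refine : ∀ i v w → (∀ k → toℕ k ≡ i → v k ≤ᵒ w k) → v ≼[ suc i ] w → v ≼[ i ] w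
    ≼-refine i v w vi≤wi (inj₁ v≺w) = inj₁ (≺-coarsen v w (ℕ.n≤1+n i) v≺w)
    ≼-refine i v w vi≤wi (inj₂ v≈w) with em {P = ∃ λ k → toℕ k ≡ i × ¬ w k ≤ᵒ v k}
    ... | yes (k , refl , wk≰vk) = inj₁ (k , ℕ.≤-refl , (vi≤wi k refl , wk≰vk) , v≈w)
    ... | no ∄k = inj₂ equal
      where
      equal : v ≈[ i ] w
      equal k i≤k with ℕ.m≤n⇒m<n∨m≡n i≤k
      ... | inj₁ i<k = v≈w k i<k
      ... | inj₂ i≡k = vi≤wi k (sym i≡k) , byContradiction λ wk≰vk → ∄k (k , sym i≡k , wk≰vk)

    ≼-extend : ∀ i v w → (∀ k → toℕ k ℕ.< i → v k ≤ᵒ w k) → v ≼[ i ] w → v ≼[ 0 ] w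
    ≼-extend zero    v w _   v≼w = v≼w
    ≼-extend (suc i) v w v≤w v≼w = ≼-extend i v w (λ k k<i → v≤w k (ℕ.m<n⇒m<1+n k<i))
      (≼-refine i v w (λ { k refl → v≤w k ℕ.≤-refl }) v≼w)

    -- Components are minimised from the last down to `i`, each among the members of `P` that agree
    -- with the current candidate on all later components. The counter `d` bounds the number of
    -- components left.
    ≼-minimum : ∀ {p} (P : Pred OrdVec p) → ∃ P → ∀ i →
      ∃ λ v → P v × (∀ w → P w → v ≼[ i ] w)
    ≼-minimum P (u , Pu) i = go m i (ℕ.m≤m+n m i)
      where
      go : ∀ d i → m ℕ.≤ d ℕ.+ i → ∃ λ v → P v × (∀ w → P w → v ≼[ i ] w)
      go zero i m≤i = u , Pu , λ w _ → inj₂ λ k i≤k →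
        ⊥-elim (ℕ.<⇒≱ (toℕ<n k) (ℕ.≤-trans m≤i i≤k))
      go (suc d) i m≤d+i
        with go d (suc i) (subst (m ℕ.≤_) (sym (ℕ.+-suc d i)) m≤d+i) | em {P = ∃ λ k → toℕ k ≡ i}
      ... | v , Pv , v-min | no ∄k =
            v , Pv , λ w Pw → ≼-refine i v w (λ k k≡i → ⊥-elim (∄k (k , k≡i))) (v-min w Pw)
      ... | v , Pv , v-min | yes (k , refl)
        with minimum (λ w → w k) (λ w → P w × w ≈[ suc i ] v) (v , Pv , ≈[]-refl (suc i) v)
      ...   | v′ , (Pv′ , v′≈v) , v′-min = v′ , Pv′ , v′-least
        where
        v′-least : ∀ w → P w → v′ ≼[ i ] w
        v′-least w Pw with v-min w Pw
        ... | inj₁ v≺w = inj₁ (≺-coarsen v′ w (ℕ.n≤1+n i) (≈-≺-trans (suc i) v′ v w v′≈v v≺w))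
        ... | inj₂ v≈w = ≼-refine i v′ w
              (λ l l≡k → subst (λ l → v′ l ≤ᵒ w l) (sym (toℕ-injective l≡k))
                (v′-min (Pw , ≈[]-sym (suc i) v w v≈w)))
              (inj₂ (≈[]-trans (suc i) v′ v w v′≈v v≈w))

    -- The two-element set of `v` and `w` has a minimum.
    ≼-total : ∀ i v w → v ≼[ i ] w ⊎ w ≼[ i ] v
    ≼-total i v w with ≼-minimum (λ u → u ≡ v ⊎ u ≡ w) (v , inj₁ refl) i
    ... | _ , inj₁ refl , v-min = inj₁ (v-min w (inj₂ refl))
    ... | _ , inj₂ refl , w-min = inj₂ (w-min v (inj₁ refl))

    ⪯-trans : ∀ i x y z → x ⪯[ i ] y → y ⪯[ i ] z → x ⪯[ i ] z
    ⪯-trans i _        _        nothing  _ _ = tt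
    ⪯-trans i (just u) (just v) (just w) p q = ≼-trans i u v w p q

    ⪯-refl : ∀ i x → x ⪯[ i ] x
    ⪯-refl i nothing  = tt
    ⪯-refl i (just v) = inj₂ (≈[]-refl i v)

    ⪯-total : ∀ x y → x ⪯ y ⊎ y ⪯ x
    ⪯-total x        nothing  = inj₁ tt
    ⪯-total nothing  (just _) = inj₂ tt
    ⪯-total (just v) (just w) = ≼-total 0 v w

    ⪯-restrict : ∀ i x y → x ⪯ y → x ⪯[ i ] y
    ⪯-restrict i x        nothing  p = tt
    ⪯-restrict i (just v) (just w) p = ≼-restrict i v w p

    ⪯-extend : ∀ i x w → All (λ v → ∀ k → toℕ k ℕ.< i → v k ≤ᵒ w k) x →
      x ⪯[ i ] just w → x ⪯ just w
    ⪯-extend i (just v) w (just v≤w) p = ≼-extend i v w v≤w p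

    -- Shifts by `δ` and replacement of initial components.

    δ-discrete : ∀ η i k {a b} → ¬ Ordinal._<_ (δ η i k) a b
    δ-discrete ν i k ()
    δ-discrete μ i k with does (k ≟ i)
    ... | false = λ ()
    ... | true  = λ ()

    -- A strict inequality at the deciding component survives the shift because 0 and 1 can be
    -- cancelled on the right.
    ⊕-mono : ∀ η i x y → x ⪯ y → (x ⊕ δ η i) ⪯ (y ⊕ δ η i)
    ⊕-mono η i x nothing _ = tt
    ⊕-mono η i (just v) (just w) (inj₂ v≈w) = inj₂ λ k _ →
      +ᵒ-monoˡ-≤ (v k) (w k) (δ η i k) (proj₁ (v≈w k z≤n)) ,
      +ᵒ-monoˡ-≤ (w k) (v k) (δ η i k) (proj₂ (v≈w k z≤n))
    ⊕-mono η i (just v) (just w) (inj₁ (k , _ , (vk≤wk , wk≰vk) , above)) = inj₁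
      ( k , z≤n
      , ( +ᵒ-monoˡ-≤ (v k) (w k) (δ η i k) vk≤wk
        , λ p → wk≰vk (+ᵒ-cancelʳ-≤ (w k) (v k) (δ η i k) (λ {a} {b} → δ-discrete η i k {a} {b}) p))
      , λ j k<j → +ᵒ-monoˡ-≤ (v j) (w j) (δ η i j) (proj₁ (above j k<j))
                , +ᵒ-monoˡ-≤ (w j) (v j) (δ η i j) (proj₂ (above j k<j)))

    -- Only position `i` of the shift can be nonzero, so a shifted vector can exceed `λᴸ` there but
    -- not below.
    ⊕-below : ∀ η i (v : OrdVec) k → toℕ k ℕ.< toℕ i → v k +ᵒ δ η i k ≤ᵒ v k
    ⊕-below ν i v k _ = x+0≤ᵒx (v k)
    ⊕-below μ i v k k<i with k ≟ i
    ... | yes refl = ⊥-elim (ℕ.<-irrefl refl k<i)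
    ... | no _     = x+0≤ᵒx (v k)

    -- With `0ᵒ` it yields the normal form required of minima; with `λᴸ`, the largest bounded tuple
    -- having the components of a bounded `v` from `i` on.
    splice : ℕ → Ordinal ℓ → OrdVec → OrdVec
    splice i α v k with toℕ k ℕ.<? i
    ... | yes _ = α
    ... | no  _ = v k

    splice-< : ∀ i α v k → toℕ k ℕ.< i → splice i α v k ≡ α
    splice-< i α v k k<i with toℕ k ℕ.<? i
    ... | yes _   = refl
    ... | no  k≮i = ⊥-elim (k≮i k<i)

    splice-≥ : ∀ i α v k → i ℕ.≤ toℕ k → splice i α v k ≡ v k
    splice-≥ i α v k i≤k with toℕ k ℕ.<? i
    ... | yes k<i = ⊥-elim (ℕ.<⇒≱ k<i i≤k)
    ... | no  _   = refl

    splice-≈ : ∀ i α v → splice i α v ≈[ i ] v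
    splice-≈ i α v k i≤k rewrite splice-≥ i α v k i≤k = ≈ᵒ-refl (v k)

    splice-≤ : ∀ i α β v → α ≤ᵒ β → (∀ k → v k ≤ᵒ β) → ∀ k → splice i α v k ≤ᵒ β
    splice-≤ i α β v α≤β v≤β k with toℕ k ℕ.<? i
    ... | yes _ = α≤β
    ... | no  _ = v≤β k

    -- Minima and suprema in `[λ]⋆`.

    module Bounds (λᴸ : Ordinal ℓ) where

      Bounded : Pred OrdVec ℓ
      Bounded u = ∀ k → u k ≤ᵒ λᴸ

      -- A ⪯ᵢ-upward closed set of vectors is determined by its least element with
      -- null components below i; ⋆ stands for the empty set.
      record Represents {p} (i : ℕ) (S : Pred OrdVec p) (x : [λ]⋆ λᴸ) : Set (Level.suc ℓ Level.⊔ p) where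
        field
          null     : All (λ v → ∀ k → toℕ k ℕ.< i → v k ≈ᵒ 0ᵒ) (proj₁ x)
          sound    : ∀ u → Bounded u → proj₁ x ⪯[ i ] just u → S u
          complete : ∀ u → Bounded u → S u → proj₁ x ⪯[ i ] just u

      open Represents public

      -- Null components lie below every ordinal, so a comparison from `i` on extends to the full
      -- order.
      ⪯-extend-null : ∀ i x u → All (λ v → ∀ k → toℕ k ℕ.< i → v k ≈ᵒ 0ᵒ) x →
        x ⪯[ i ] just u → x ⪯ just u
      ⪯-extend-null i (just v) u (just v≈0) = ⪯-extend i (just v) u (just λ k k<i →
        ≤ᵒ-trans (v k) 0ᵒ (u k) (proj₁ (v≈0 k k<i)) (0≤ᵒ (u k)))

      -- The representative is a lexicographic minimum of the bounded members of `S`, with its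
      -- components below `i` reset to `0ᵒ`.
      represent : ∀ {p} i (S : Pred OrdVec p) →
        (∀ u w → Bounded w → u ≼[ i ] w → S u → S w) → ∃ (Represents i S)
      represent i S S-up with em {P = ∃ λ u → Bounded u × S u}
      ... | no ∄u = (nothing , nothing) , record
        { null     = nothing
        ; sound    = λ _ _ ()
        ; complete = λ u u≤λ Su → ⊥-elim (∄u (u , u≤λ , Su))
        }
      ... | yes inhabited with ≼-minimum (λ u → Bounded u × S u) inhabited i
      ...   | v , (v≤λ , Sv) , v-min =
        (just v₀ , just (splice-≤ i 0ᵒ λᴸ v (0≤ᵒ λᴸ) v≤λ)) , record
        { null     = just λ k k<i → subst (_≈ᵒ 0ᵒ) (sym (splice-< i 0ᵒ v k k<i)) (≈ᵒ-refl 0ᵒ)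
        ; sound    = λ u u≤λ v₀≼u → S-up v u u≤λ
            (≼-trans i v v₀ u (inj₂ (≈[]-sym i v₀ v v₀≈v)) v₀≼u) Sv
        ; complete = λ u u≤λ Su → ≼-trans i v₀ v u (inj₂ v₀≈v) (v-min u (u≤λ , Su))
        }
        where
        v₀ : OrdVec
        v₀ = splice i 0ᵒ v
        v₀≈v : v₀ ≈[ i ] v
        v₀≈v = splice-≈ i 0ᵒ v

      _≤Some_ : ∀ {p} → Pred ([λ]⋆ λᴸ) p → ℕ → Pred OrdVec _
      (X ≤Some i) u = ∃ λ y → y ∈ X × proj₁ y ⪯[ i ] just u

      -- Soundness at the representative itself yields a member of `X` below it; completeness gives
      -- the reverse inequality, so the minimum is attained.
      IsMin-intro : ∀ {p} i (X : Pred ([λ]⋆ λᴸ) p) x → Represents i (X ≤Some i) x → IsMin λᴸ i X x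
      IsMin-intro i X (nothing , _) rep {nothing , _}       y∈X = refl
      IsMin-intro i X (nothing , _) rep {just w , just w≤λ} y∈X =
        ⊥-elim (lower (complete rep w w≤λ (_ , y∈X , ⪯-refl i (just w))))
      IsMin-intro i X (just v , just v≤λ) rep with null rep | sound rep v v≤λ (⪯-refl i (just v))
      ... | just v≈0 | (just w , just w≤λ) , w∈X , w≼v =
        v≈0 , (w , just w≤λ , w∈X , ≼-antisym i v w (v-min w∈X) w≼v) , v-min
        where
        v-min : ∀ {y} → y ∈ X → just v ⪯[ i ] proj₁ y
        v-min {nothing , _}       y∈X = tt
        v-min {just u , just u≤λ} y∈X = complete rep u u≤λ (_ , y∈X , ⪯-refl i (just u))

      -- The indices are separate because a disjunction takes its minimum from component 0 on, while
      -- its value is compared from a later component on.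
      IsMin-attained : ∀ {p} i j (X : Pred ([λ]⋆ λᴸ) p) x u → i ℕ.≤ j → IsMin λᴸ i X x →
        proj₁ x ⪯[ j ] just u → (X ≤Some j) u
      IsMin-attained i j X (just v , _) u i≤j (_ , (w , w≤λ , w∈X , v≈w) , _) v≼u =
        (just w , w≤λ) , w∈X , ≼-trans j w v u (inj₂ λ k j≤k → ≈ᵒ-sym (v k) (w k) (v≈w k (ℕ.≤-trans i≤j j≤k))) v≼u

      IsMin-exists : ∀ {p} i (X : Pred ([λ]⋆ λᴸ) p) → ∃ (IsMin λᴸ i X)
      IsMin-exists i X with represent i (X ≤Some i)
        (λ u w _ u≼w (y , y∈X , y⪯u) → y , y∈X , ⪯-trans i (proj₁ y) (just u) (just w) y⪯u u≼w)
      ... | x , rep = x , IsMin-intro i X x rep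

      IsMin-unique : ∀ {p} i (X : Pred ([λ]⋆ λᴸ) p) x y → IsMin λᴸ i X x → IsMin λᴸ i X y →
        proj₁ x ⪯ proj₁ y
      IsMin-unique i X x (nothing , _) _ _ = tt
      IsMin-unique i X (nothing , _) (just w , _) x-min (_ , (_ , _ , w′∈X , _) , _) with x-min w′∈X
      ... | ()
      IsMin-unique i X (just v , _) (just w , _) (v≈0 , _ , v-min) (_ , (w′ , _ , w′∈X , w≈w′) , _) =
        ⪯-extend-null i (just v) w (just v≈0)
          (≼-trans i v w′ w (v-min w′∈X) (inj₂ (≈[]-sym i w w′ w≈w′)))

      IsSup-exists : ∀ {p} (X : Pred OrdVec⋆ p) → ∃ (IsSup λᴸ X)
      IsSup-exists X with em {P = ∃ λ u → Bounded u × (∀ {y} → y ∈ X → y ⪯ just u)}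
      ... | no ∄u = (nothing , nothing) , (λ _ → tt) , λ where
        (nothing , _)       _     → tt
        (just u , just u≤λ) X≤u → ⊥-elim (∄u (u , u≤λ , X≤u))
      ... | yes bounded with ≼-minimum (λ u → Bounded u × (∀ {y} → y ∈ X → y ⪯ just u)) bounded 0
      ...   | v , (v≤λ , X≤v) , v-min = (just v , just v≤λ) , X≤v , λ where
        (nothing , _)       _   → tt
        (just u , just u≤λ) X≤u → v-min u (u≤λ , X≤u)

      -- ⪯ᵢ-bounds of X become ⪯-bounds once their components below i are raised to λᴸ.
      IsSup-least : ∀ {p} i (X : Pred OrdVec⋆ p) x → IsSup λᴸ X x →
        (∀ {y} → y ∈ X → All (λ v → ∀ k → toℕ k ℕ.< i → v k ≤ᵒ λᴸ) y) →
        ∀ u → Bounded u → (∀ {y} → y ∈ X → y ⪯[ i ] just u) → proj₁ x ⪯[ i ] just u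
      IsSup-least i X x (_ , x-least) X≤λ u u≤λ X≤u =
        ⪯-trans i (proj₁ x) (just t) (just u) (⪯-restrict i (proj₁ x) (just t) x⪯t) (inj₂ t≈u)
        where
        t : OrdVec
        t = splice i λᴸ u
        t≈u : t ≈[ i ] u
        t≈u = splice-≈ i λᴸ u
        y⪯t : ∀ {y} → y ∈ X → y ⪯ just t
        y⪯t {y} y∈X = ⪯-extend i y t
          (Maybe.map (λ {v} v≤λ k k<i → subst (v k ≤ᵒ_) (sym (splice-< i λᴸ u k k<i)) (v≤λ k k<i)) (X≤λ y∈X))
          (⪯-trans i y (just u) (just t) (X≤u y∈X) (inj₂ (≈[]-sym i t u t≈u)))
        x⪯t : proj₁ x ⪯ just t
        x⪯t = x-least (just t , just (splice-≤ i λᴸ λᴸ u (≤ᵒ-refl λᴸ) u≤λ)) y⪯t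

  -- Approximation in the lattice and the tuple `G`.

  module LeastSolution {ℓ : Level} (L : CompleteLattice ℓ)
    (continuous : CompleteLattice.IsContinuous L)
    (B : Pred (CompleteLattice.Carrier L) ℓ) (basis : CompleteLattice.IsBasis L B)
    (⊥∉B : ∀ {b} → b ∈ B → ¬ (CompleteLattice._≈_ L b (CompleteLattice.⊥ᴸ L)))
    (λᴸ : Ordinal ℓ) (m : ℕ) (E : System L m)
    where

    open CompleteLattice L
    open Poset poset using () renaming (refl to ⊑-refl; trans to ⊑-trans; antisym to ⊑-antisym)
    open OrdinalVectors {ℓ} m
    open Equations L B λᴸ m
    open System E
    open Vectors {ℓ} m
    open Bounds λᴸ

    x∈P⇒x⊑⨆P : ∀ (P : Pred Carrier ℓ) {x} → x ∈ P → x ⊑ ⨆ P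
    x∈P⇒x⊑⨆P P = proj₁ (⨆-isLub P)

    ⨆-least : ∀ (P : Pred Carrier ℓ) u → (∀ {x} → x ∈ P → x ⊑ u) → ⨆ P ⊑ u
    ⨆-least P = proj₂ (⨆-isLub P)

    ⊥⊑ : ∀ x → ⊥ᴸ ⊑ x
    ⊥⊑ x = ⨆-least _ x λ ()

    -- By continuity `x` is the join of all `z ≪ x`; each such `z` is the join of the basis elements
    -- below it, which are again way below `x`.
    approximation : ∀ x y → (∀ (b : Basis) → proj₁ b ≪ x → proj₁ b ⊑ y) → x ⊑ y
    approximation x y below⊑y = proj₂ (continuous x) y λ {z} z≪x →
      proj₂ (basis z) y λ {b} (b∈B , b⊑z) → below⊑y (b , b∈B) λ D directed x⊑⨆D →
        let (d , d∈D , z⊑d) = z≪x D directed x⊑⨆D in d , d∈D , ⊑-trans b⊑z z⊑d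

    -- At R*, the largest tuple l whose approximants 𝐀(l) can all have shifted measure ⪯ᵢ u.
    G : Measure → Fin m → OrdVec → Vector Carrier m
    G R i u j = ⨆ λ c → Σ (c ∈ B) λ c∈B → shifted E R i (c , c∈B) j ⪯[ toℕ i ] just u

    ⊑G : ∀ R i u j b → shifted E R i b j ⪯[ toℕ i ] just u → proj₁ b ⊑ G R i u j
    ⊑G R i u j (b , b∈B) p = x∈P⇒x⊑⨆P _ (b∈B , p)

    G-mono : ∀ R i u w → u ≼[ toℕ i ] w → ∀ j → G R i u j ⊑ G R i w j
    G-mono R i u w u≼w j = ⨆-least _ _ λ {c} (c∈B , p) → ⊑G R i w j (c , c∈B)
      (⪯-trans (toℕ i) (shifted E R i (c , c∈B) j) (just u) (just w) p u≼w)

    -- The order on measures and the least prefixed measure.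

    _≤ᴹ_ : Rel Measure ℓ
    R ≤ᴹ R′ = ∀ b i → proj₁ (R b i) ⪯ proj₁ (R′ b i)

    G-anti : ∀ R R′ → R ≤ᴹ R′ → ∀ i u j → G R′ i u j ⊑ G R i u j
    G-anti R R′ R≤R′ i u j = ⨆-least _ _ λ {c} (c∈B , p) → ⊑G R i u j (c , c∈B)
      (⪯-trans (toℕ i) (shifted E R i (c , c∈B) j) (shifted E R′ i (c , c∈B) j) (just u)
        (⪯-restrict (toℕ i) (shifted E R i (c , c∈B) j) (shifted E R′ i (c , c∈B) j)
          (⊕-mono (η i) i (proj₁ (R (c , c∈B) j)) (proj₁ (R′ (c , c∈B) j)) (R≤R′ (c , c∈B) j)))
        p)

    ⟦⟧-mono : ∀ ψ {l l′ : Vector Carrier m} → (∀ j → l j ⊑ l′ j) → l ∈ ⟦ ψ ⟧ → l′ ∈ ⟦ ψ ⟧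
    ⟦⟧-mono [ b , j ] l⊑l′ b⊑l       = ⊑-trans b⊑l (l⊑l′ j)
    ⟦⟧-mono (⋁ φ)     l⊑l′ (k , l∈φ) = k , ⟦⟧-mono (φ k) l⊑l′ l∈φ
    ⟦⟧-mono (⋀ φ)     l⊑l′ l∈φ k     = ⟦⟧-mono (φ k) l⊑l′ (l∈φ k)

    -- These are the pre-fixed points of the operator taking `R` to the measure whose value at `b`
    -- and `i` represents the set of `u` with `b ⊑ f i (G R i u)`. The operator is monotone by
    -- `G-anti`.
    Prefixed : Pred Measure (Level.suc ℓ)
    Prefixed R = ∀ b i u → Bounded u → proj₁ (R b i) ⪯[ toℕ i ] just u → proj₁ b ⊑ f i (G R i u)

    -- An infimum of measures corresponds to a union of sets of upper bounds. The condition
    -- `b ⊑ f i (G R i u)` in place of `R b i ⪯[ toℕ i ] just u` builds one application of the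
    -- operator into that infimum.
    SomePrefixed : Basis → Fin m → Pred OrdVec (Level.suc ℓ)
    SomePrefixed b i u = ∃ λ R → Prefixed R × proj₁ b ⊑ f i (G R i u)

    leastRepresents : ∀ b i → ∃ (Represents (toℕ i) (SomePrefixed b i))
    leastRepresents b i = represent (toℕ i) (SomePrefixed b i)
      λ u w _ u≼w (R , R-pre , b⊑) → R , R-pre , ⊑-trans b⊑ (f-mono i (G-mono R i u w u≼w))

    R* : Measure
    R* b i = proj₁ (leastRepresents b i)

    R*-least : ∀ R → Prefixed R → R* ≤ᴹ R
    R*-least R R-pre b i with R b i in eq
    ... | nothing , _       = tt
    ... | just u , just u≤λ = ⪯-extend-null (toℕ i) (proj₁ (R* b i)) u (null rep)
          (complete rep u u≤λ (R , R-pre , R-pre b i u u≤λ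
            (subst (λ x → proj₁ x ⪯[ toℕ i ] just u) (sym eq) (⪯-refl (toℕ i) (just u)))))
      where rep = proj₂ (leastRepresents b i)

    -- The Knaster-Tarski argument: `R*` lies below every prefixed `R`, so `G R i u ⊑ G R* i u` and
    -- `R*` is prefixed; it is then itself a witness for `SomePrefixed`, which gives the converse.
    R*-represents : ∀ b i → Represents (toℕ i) (λ u → proj₁ b ⊑ f i (G R* i u)) (R* b i)
    R*-represents b i = record
      { null     = null rep
      ; sound    = R*-prefixed b i
      ; complete = λ u u≤λ b⊑ → complete rep u u≤λ (R* , R*-prefixed , b⊑)
      }
      where
      rep = proj₂ (leastRepresents b i)
      R*-prefixed : Prefixed R*
      R*-prefixed b i u u≤λ p =
        let (R , R-pre , b⊑) = sound (proj₂ (leastRepresents b i)) u u≤λ p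
        in ⊑-trans b⊑ (f-mono i (G-anti R* R (R*-least R R-pre) i u))

    Below : Fin m → OrdVec⋆ → Pred Carrier ℓ
    Below j y c = Σ (c ∈ B) λ c∈B → proj₁ (R* (c , c∈B) j) ⪯ y

    -- For a tuple `u`, every element of the sublevel set lies below `f j (G R* j u)`; hence so do
    -- their join and `b`.
    R*-joinClosed : ∀ b j (y : [λ]⋆ λᴸ) → proj₁ b ⊑ ⨆ (Below j (proj₁ y)) → proj₁ (R* b j) ⪯ proj₁ y
    R*-joinClosed b j (nothing , _)       _  = tt
    R*-joinClosed b j (just u , just u≤λ) b⊑ =
      ⪯-extend-null (toℕ j) (proj₁ (R* b j)) u (null (R*-represents b j))
        (complete (R*-represents b j) u u≤λ (⊑-trans b⊑ (⨆-least _ _ λ {c} (c∈B , p) →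
          sound (R*-represents (c , c∈B) j) u u≤λ
            (⪯-restrict (toℕ j) (proj₁ (R* (c , c∈B) j)) (just u) p))))

    -- At limit ordinals, a supremum of measures whose shifts are ⪯ᵢ u need not have its
    -- shift ⪯ᵢ u; the relation ≪ reduces the supremum to a single measure.
    ≪G⇒shifted⪯ : ∀ i u j (b : Basis) x → proj₁ b ≪ x → x ⊑ G R* i u j →
      shifted E R* i b j ⪯[ toℕ i ] just u
    ≪G⇒shifted⪯ i u j b x b≪x x⊑G = conclude (b≪x D ((⊥ᴸ , inj₁ (⊥⊑ _)) , upper) (⊑-trans x⊑G G⊑⨆D))
      where
      Admissible : Pred Basis ℓ
      Admissible c = shifted E R* i c j ⪯[ toℕ i ] just u
      -- Joins of sublevel sets at measures of admissible elements form a chain, since `⪯` is total.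
      -- `D` is the downward closure of this chain together with `⊥ᴸ`, which keeps it inhabited when
      -- nothing is admissible.
      D : Pred Carrier ℓ
      D y = y ⊑ ⊥ᴸ ⊎ ∃ λ c → c ∈ Admissible × y ⊑ ⨆ (Below j (proj₁ (R* c j)))
      ⨆Below-mono : ∀ c d → proj₁ (R* c j) ⪯ proj₁ (R* d j) →
        ⨆ (Below j (proj₁ (R* c j))) ⊑ ⨆ (Below j (proj₁ (R* d j)))
      ⨆Below-mono c d p = ⨆-least _ _ λ {e} (e∈B , q) → x∈P⇒x⊑⨆P _
        (e∈B , ⪯-trans 0 (proj₁ (R* (e , e∈B) j)) (proj₁ (R* c j)) (proj₁ (R* d j)) q p)
      upper : ∀ {y z} → y ∈ D → z ∈ D → ∃ λ w → w ∈ D × y ⊑ w × z ⊑ w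
      upper {y} {z} (inj₁ y⊑⊥) z∈D = z , z∈D , ⊑-trans y⊑⊥ (⊥⊑ z) , ⊑-refl
      upper {y} {z} (inj₂ y∈D) (inj₁ z⊑⊥) = y , inj₂ y∈D , ⊑-refl , ⊑-trans z⊑⊥ (⊥⊑ y)
      upper (inj₂ (c , c-adm , y⊑)) (inj₂ (d , d-adm , z⊑))
        with ⪯-total (proj₁ (R* c j)) (proj₁ (R* d j))
      ... | inj₁ p = _ , inj₂ (d , d-adm , ⊑-refl) , ⊑-trans y⊑ (⨆Below-mono c d p) , z⊑
      ... | inj₂ p = _ , inj₂ (c , c-adm , ⊑-refl) , y⊑ , ⊑-trans z⊑ (⨆Below-mono d c p)
      G⊑⨆D : G R* i u j ⊑ ⨆ D
      G⊑⨆D = ⨆-least _ _ λ {c} (c∈B , p) → x∈P⇒x⊑⨆P D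
        (inj₂ ((c , c∈B) , p , x∈P⇒x⊑⨆P _ (c∈B , ⪯-refl 0 (proj₁ (R* (c , c∈B) j)))))
      conclude : (∃ λ d → d ∈ D × proj₁ b ⊑ d) → shifted E R* i b j ⪯[ toℕ i ] just u
      -- A basis element below `⊥ᴸ` would equal it, which `⊥∉B` excludes.
      conclude (d , inj₁ d⊑⊥ , b⊑d) =
        ⊥-elim (⊥∉B (proj₂ b) (⊑-antisym (⊑-trans b⊑d d⊑⊥) (⊥⊑ _)))
      -- The measure of `b` is bounded by that of the single admissible element `c`, and shifting
      -- preserves this bound.
      conclude (d , inj₂ (c , c-adm , d⊑) , b⊑d) =
        ⪯-trans (toℕ i) (shifted E R* i b j) (shifted E R* i c j) (just u)
          (⪯-restrict (toℕ i) (shifted E R* i b j) (shifted E R* i c j)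
            (⊕-mono (η i) i (proj₁ (R* b j)) (proj₁ (R* c j))
              (R*-joinClosed b j (R* c j) (⊑-trans b⊑d d⊑))))
          c-adm

    -- The progress measure equations.

    shifted-bounded : ∀ R i b j →
      All (λ v → ∀ k → toℕ k ℕ.< toℕ i → v k ≤ᵒ λᴸ) (shifted E R i b j)
    shifted-bounded R i b j with R b j
    ... | nothing , _       = nothing
    ... | just v , just v≤λ = just λ k k<i →
          ≤ᵒ-trans (v k +ᵒ δ (η i) i k) (v k) λᴸ (⊕-below (η i) i v k k<i) (v≤λ k)

    ⊑G-from-sup : ∀ R i u b j {p} (X : Pred OrdVec⋆ p) y → IsSup λᴸ X y →
      proj₁ y ⪯[ toℕ i ] just u → shifted E R i b j ∈ X → proj₁ b ⊑ G R i u j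
    ⊑G-from-sup R i u b j X y (X≤y , _) y⪯u b∈X = ⊑G R i u j b
      (⪯-trans (toℕ i) (shifted E R i b j) (proj₁ y) (just u)
        (⪯-restrict (toℕ i) (shifted E R i b j) (proj₁ y) (X≤y b∈X)) y⪯u)

    -- The minimum is attained at some `l` with `b ⊑ f i l`. All approximants of `l` have shifted
    -- measure `⪯[ toℕ i ]` the bound `u`, so `l` lies below `G R i u`.
    progressMeasureEqs⇒prefixed : ∀ R → SolvesProgressMeasureEqs E R → Prefixed R
    progressMeasureEqs⇒prefixed R solves b i u u≤λ p
      with IsMin-attained (toℕ i) (toℕ i) _ (R b i) u ℕ.≤-refl (solves b i) p
    ... | y , (l , l∈E , y-sup) , y⪯u = ⊑-trans l∈E (f-mono i λ j →
          approximation (l j) (G R i u j) λ c c≪l →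
            ⊑G-from-sup R i u c j _ y y-sup y⪯u (c , j , c≪l , refl))

    R*-solvesProgressMeasureEqs : SolvesProgressMeasureEqs E R*
    R*-solvesProgressMeasureEqs b i = IsMin-intro (toℕ i) _ (R* b i) record
      { null     = null (R*-represents b i)
      -- The move chosen is `G R* i u` itself; its approximants have shifted measure
      -- `⪯[ toℕ i ] just u` by `≪G⇒shifted⪯`.
      ; sound    = λ u u≤λ p →
          let (y , y-sup) = IsSup-exists (λ z → ∃₂ λ b′ j → (b′ , j) ∈ 𝐀 (G R* i u) × z ≡ shifted E R* i b′ j)
          in y , (G R* i u , sound (R*-represents b i) u u≤λ p , y-sup) ,
             IsSup-least (toℕ i) _ y y-sup (λ { (c , j , _ , refl) → shifted-bounded R* i c j }) u u≤λ
               (λ { (c , j , c≪G , refl) → ≪G⇒shifted⪯ i u j c _ c≪G ⊑-refl })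
      ; complete = λ { u u≤λ (y , (l , l∈E , y-sup) , y⪯u) →
          complete (R*-represents b i) u u≤λ (⊑-trans l∈E (f-mono i λ j →
            approximation (l j) (G R* i u j) λ c c≪l →
              ⊑G-from-sup R* i u c j _ y y-sup y⪯u (c , j , c≪l , refl))) }
      }

    -- Atom clauses.

    record IsAdequate (b : Basis) (j : Fin m)
      (C : Measure → Fin m → Pred ([λ]⋆ λᴸ) (Level.suc ℓ)) : Set (Level.suc ℓ) where
      field
        C-exists   : ∀ R i → ∃ (C R i)
        C-unique   : ∀ R i x y → C R i x → C R i y → proj₁ x ⪯ proj₁ y
        -- Soundness is asked at every measure, as it shows arbitrary solutions to be prefixed;
        -- completeness is asked only at `R*`.
        C-sound    : ∀ R i x u → C R i x → proj₁ x ⪯[ toℕ i ] just u → proj₁ b ⊑ G R i u j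
        C-complete : ∀ i x → Represents (toℕ i) (λ u → proj₁ b ⊑ G R* i u j) x → C R* i x

    open IsAdequate

    -- Serves both forms of the atom clause, which differ only in the set `Z` whose supremum is
    -- taken.
    min-sup-adequate : ∀ b j (Z : Measure → Fin m → Pred OrdVec⋆ (Level.suc ℓ)) →
      (∀ R i {z} → z ∈ Z R i → All (λ v → ∀ k → toℕ k ℕ.< toℕ i → v k ≤ᵒ λᴸ) z) →
      (∀ R i u → (∀ c → shifted E R i c j ∈ Z R i → proj₁ c ⊑ G R i u j) → proj₁ b ⊑ G R i u j) →
      (∀ i u → proj₁ b ⊑ G R* i u j → ∀ {z} → z ∈ Z R* i → z ⪯[ toℕ i ] just u) →
      IsAdequate b j λ R i → IsMin λᴸ (toℕ i) (IsSup λᴸ (Z R i))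
    min-sup-adequate b j Z Z-bounded Z-sound Z-complete = record
      { C-exists   = λ R i → IsMin-exists (toℕ i) _
      ; C-unique   = λ R i → IsMin-unique (toℕ i) _
      ; C-sound    = λ R i x u x-min x⪯u →
          let (y , y-sup , y⪯u) = IsMin-attained (toℕ i) (toℕ i) _ x u ℕ.≤-refl x-min x⪯u
          in Z-sound R i u λ c → ⊑G-from-sup R i u c j (Z R i) y y-sup y⪯u
      ; C-complete = λ i x rep → IsMin-intro (toℕ i) _ x record
          { null     = null rep
          ; sound    = λ u u≤λ x⪯u →
              let (y , y-sup) = IsSup-exists (Z R* i)
              in y , y-sup , IsSup-least (toℕ i) (Z R* i) y y-sup (Z-bounded R* i) u u≤λ
                   (Z-complete i u (sound rep u u≤λ x⪯u))
          ; complete = λ { u u≤λ (y , y-sup , y⪯u) → complete rep u u≤λ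
              (Z-sound R* i u λ c → ⊑G-from-sup R* i u c j (Z R* i) y y-sup y⪯u) }
          }
      }

    atomClause-adequate : ∀ b j → IsAdequate b j λ R i → atomClause E R i b j
    atomClause-adequate b j = min-sup-adequate b j
      (λ R i z → ∃ λ c → proj₁ c ≪ proj₁ b × z ≡ shifted E R i c j)
      (λ { R i (c , _ , refl) → shifted-bounded R i c j })
      (λ R i u c⊑G → approximation (proj₁ b) (G R i u j) λ c c≪b → c⊑G c (c , c≪b , refl))
      (λ { i u b⊑G (c , c≪b , refl) → ≪G⇒shifted⪯ i u j c _ c≪b b⊑G })

    compactClause-adequate : ∀ b j → Compact (proj₁ b) →
      IsAdequate b j λ R i → compactClause E R i b j
    compactClause-adequate b j b≪b = min-sup-adequate b j
      (λ R i z → z ≡ shifted E R i b j)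
      (λ { R i refl → shifted-bounded R i b j })
      (λ R i u c⊑G → c⊑G b refl)
      (λ { i u b⊑G refl → ≪G⇒shifted⪯ i u j b _ b≪b b⊑G })

    atomClauseᶜ-adequate : ∀ b j → IsAdequate b j λ R i → atomClauseᶜ E R i b j
    atomClauseᶜ-adequate b j with em {P = Compact (proj₁ b)}
    ... | yes b≪b = record
      { C-exists   = λ R i → let (x , Cx) = C-exists A R i in x , (λ _ → Cx) , λ b≪̸b → ⊥-elim (b≪̸b b≪b)
      ; C-unique   = λ R i x y (Cx , _) (Cy , _) → C-unique A R i x y (Cx b≪b) (Cy b≪b)
      ; C-sound    = λ R i x u (Cx , _) → C-sound A R i x u (Cx b≪b)
      ; C-complete = λ i x rep → (λ _ → C-complete A i x rep) , λ b≪̸b → ⊥-elim (b≪̸b b≪b)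
      }
      where A = compactClause-adequate b j b≪b
    ... | no b≪̸b = record
      { C-exists   = λ R i → let (x , Cx) = C-exists A R i in x , (λ b≪b → ⊥-elim (b≪̸b b≪b)) , λ _ → Cx
      ; C-unique   = λ R i x y (_ , Cx) (_ , Cy) → C-unique A R i x y (Cx b≪̸b) (Cy b≪̸b)
      ; C-sound    = λ R i x u (_ , Cx) → C-sound A R i x u (Cx b≪̸b)
      ; C-complete = λ i x rep → (λ b≪b → ⊥-elim (b≪̸b b≪b)) , λ _ → C-complete A i x rep
      }
      where A = atomClause-adequate b j

    -- Values of formulae.

    module _ (clause : AtomClause E) (adequate : ∀ b j → IsAdequate b j λ R i → clause R i b j) where

      Value-exists : ∀ R i ψ → ∃ (Value E clause R i ψ)
      Value-exists R i [ b , j ] = C-exists (adequate b j) R i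
      Value-exists R i (⋁ φ)     = IsMin-exists 0 _
      Value-exists R i (⋀ φ)     = IsSup-exists _

      Value-unique : ∀ R i ψ x y → Value E clause R i ψ x → Value E clause R i ψ y → proj₁ x ⪯ proj₁ y
      Value-unique R i [ b , j ] = C-unique (adequate b j) R i
      Value-unique R i (⋁ φ)     = IsMin-unique 0 _
      Value-unique R i (⋀ φ) x y (_ , x-least) (≤y , _) = x-least y ≤y

      Value-sound : ∀ R i ψ x u → Value E clause R i ψ x → proj₁ x ⪯[ toℕ i ] just u → G R i u ∈ ⟦ ψ ⟧
      Value-sound R i [ b , j ] x u Vx x⪯u = C-sound (adequate b j) R i x u Vx x⪯u
      Value-sound R i (⋁ φ) x u Vx x⪯u =
        let (y , (k , Vy) , y⪯u) = IsMin-attained 0 (toℕ i) _ x u z≤n Vx x⪯u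
        in k , Value-sound R i (φ k) y u Vy y⪯u
      Value-sound R i (⋀ φ) x u (≤x , _) x⪯u k =
        -- The supremum constrains a conjunct only through a value it actually has, so existence of
        -- that value is needed.
        let (y , Vy) = Value-exists R i (φ k)
        in Value-sound R i (φ k) y u Vy (⪯-trans (toℕ i) (proj₁ y) (proj₁ x) (just u)
             (⪯-restrict (toℕ i) (proj₁ y) (proj₁ x) (≤x (k , y , Vy , refl))) x⪯u)

      G-represents : ∀ i ψ → ∃ (Represents (toℕ i) λ u → G R* i u ∈ ⟦ ψ ⟧)
      G-represents i ψ = represent (toℕ i) (λ u → G R* i u ∈ ⟦ ψ ⟧)
        λ u w _ u≼w → ⟦⟧-mono ψ (G-mono R* i u w u≼w)

      -- Minimum and supremum of values match union and intersection of the represented sets. Null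
      -- components below `i` reconcile the full order used by the connectives with comparison from
      -- `i` on.
      Value-complete : ∀ i ψ x → Represents (toℕ i) (λ u → G R* i u ∈ ⟦ ψ ⟧) x → Value E clause R* i ψ x
      Value-complete i [ b , j ] x rep = C-complete (adequate b j) i x rep
      Value-complete i (⋁ φ) x rep = IsMin-intro 0 _ x record
        { null     = Maybe.map (λ _ k ()) (null rep)
        ; sound    = λ u u≤λ x⪯u →
            let (k , G∈φ) = sound rep u u≤λ (⪯-restrict (toℕ i) (proj₁ x) (just u) x⪯u)
                (y , y-rep) = G-represents i (φ k)
            in y , (k , Value-complete i (φ k) y y-rep) ,
               ⪯-extend-null (toℕ i) (proj₁ y) u (null y-rep) (complete y-rep u u≤λ G∈φ)
        ; complete = λ { u u≤λ (y , (k , Vy) , y⪯u) →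
            ⪯-extend-null (toℕ i) (proj₁ x) u (null rep) (complete rep u u≤λ
              (k , Value-sound R* i (φ k) y u Vy (⪯-restrict (toℕ i) (proj₁ y) (just u) y⪯u))) }
        }
      Value-complete i (⋀ φ) x rep = upper x rep , x-least
        where
        upper : ∀ x → Represents (toℕ i) (λ u → G R* i u ∈ ⟦ ⋀ φ ⟧) x →
          ∀ {z} → (∃₂ λ k y → Value E clause R* i (φ k) y × z ≡ proj₁ y) → z ⪯ proj₁ x
        upper (nothing , _)       rep _ = tt
        -- An arbitrary value `y` of the conjunct is replaced, by uniqueness, with the
        -- representative `y′`, whose null components allow the bound to be extended.
        upper (just v , just v≤λ) rep (k , y , Vy , refl) =
          let (y′ , y′-rep) = G-represents i (φ k)
          in ⪯-trans 0 (proj₁ y) (proj₁ y′) (just v)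
               (Value-unique R* i (φ k) y y′ Vy (Value-complete i (φ k) y′ y′-rep))
               (⪯-extend-null (toℕ i) (proj₁ y′) v (null y′-rep)
                 (complete y′-rep v v≤λ (sound rep v v≤λ (⪯-refl (toℕ i) (just v)) k)))
        x-least : ∀ (u : [λ]⋆ λᴸ) →
          (∀ {z} → (∃₂ λ k y → Value E clause R* i (φ k) y × z ≡ proj₁ y) → z ⪯ proj₁ u) →
          proj₁ x ⪯ proj₁ u
        x-least (nothing , _)       _  = tt
        x-least (just u , just u≤λ) ≤u =
          ⪯-extend-null (toℕ i) (proj₁ x) u (null rep) (complete rep u u≤λ λ k →
            let (y , y-rep) = G-represents i (φ k)
                Vy          = Value-complete i (φ k) y y-rep
            in Value-sound R* i (φ k) y u Vy
                 (⪯-restrict (toℕ i) (proj₁ y) (just u) (≤u (k , y , Vy , refl))))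

      -- The move enters only through its semantics: membership of `G R i u` in `⟦ φ b i ⟧` is the
      -- same as `b ⊑ f i (G R i u)`, so solutions are prefixed and `R*` has the required values.
      R*-leastSymbolic : ∀ φ → IsSymbolicMove E φ → IsLeast (SolvesSymbolicEqs E clause φ) R*
      R*-leastSymbolic φ move = solves , λ R R-solves → R*-least R λ b i u _ x⪯u →
          proj₁ (move b i) (Value-sound R i (φ b i) (R b i) u (R-solves b i) x⪯u)
        where
        solves : SolvesSymbolicEqs E clause φ R*
        solves b i = Value-complete i (φ b i) (R* b i) record
          { null     = null (R*-represents b i)
          ; sound    = λ u u≤λ x⪯u → proj₂ (move b i) (sound (R*-represents b i) u u≤λ x⪯u)
          ; complete = λ u u≤λ G∈φ → complete (R*-represents b i) u u≤λ (proj₁ (move b i) G∈φ)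
          }

-- The common least solution of the three systems.

proposition5p21 : (∀ {a} → ExcludedMiddle a) →
    ∀ {ℓ : Level} (L : CompleteLattice ℓ) → CompleteLattice.IsContinuous L →
    (B : Pred (CompleteLattice.Carrier L) ℓ) → CompleteLattice.IsBasis L B →
    (∀ {b} → b ∈ B → ¬ (CompleteLattice._≈_ L b (CompleteLattice.⊥ᴸ L))) →
    (λᴸ : Ordinal ℓ) → CompleteLattice.IsHeight L λᴸ →
    (m : ℕ) (E : System L m) →
    let open Equations L B λᴸ m in
    (φ : Basis → Fin m → Formula) → IsSymbolicMove E φ →
    ∃ λ (R : Measure) →
    IsLeast (SolvesProgressMeasureEqs E) R ×
    IsLeast (SolvesSymbolicEqs E (atomClause E) φ) R ×
    IsLeast (SolvesSymbolicEqs E (atomClauseᶜ E) φ) R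
proposition5p21 em L continuous B basis ⊥∉B λᴸ _ m E φ move =
  R* ,
  (R*-solvesProgressMeasureEqs , λ R solves → R*-least R (progressMeasureEqs⇒prefixed R solves)) ,
  R*-leastSymbolic (atomClause E) atomClause-adequate φ move ,
  R*-leastSymbolic (atomClauseᶜ E) atomClauseᶜ-adequate φ move
  where
  open Equations L B λᴸ m
  open Classical.LeastSolution em L continuous B basis ⊥∉B λᴸ m E
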